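{- For every integer $n\ge 1$, the map $\theta$ is a bijection between $\mathcal{M}'_n$ and $\mathcal{M}_n$.
   Context: All matrices are square with nonnegative integer entries. $\dim(A)$ is the number of rows of $A$; the weight $w(A)$ is the sum of the entries; rows are numbered from top to bottom and columns from left to right, starting from $1$. For a matrix $A$ whose $j$-th column is nonzero, $\mathrm{rmax}_j(A)$ and $\mathrm{rmin}_j(A)$ are the largest and the smallest index $i$ with $A_{i,j}>0$. For $1\le k\le \dim(A)$, $A[k]$ is the submatrix formed by the first $k$ rows and first $k$ columns of $A$. A Fishburn matrix is an upper triangular matrix with nonnegative integer entries in which every row and every column contains at least one nonzero entry. $\mathcal{M}_n$ is the set of Fishburn matrices of weight $n$ (of any dimension). $\mathcal{M}'_n$ is the set of upper triangular matrices $A$ with nonnegative integer entries (of any dimension) such that: the weight of $A$ is $n$; $A$ has no zero column; and $\mathrm{rmax}_{j+1}(A)>\mathrm{rmin}_j(A)$ for all $1\le j\le\dim(A)-1$. Transformation $\alpha$: let $A$ have $\dim(A)=m$ and $\mathrm{rmax}_m(A)=i$. (1) If $i=m$, then $\alpha(A)=A$. (2) If $i<m$: in $A[m-1]$ insert a new zero row between rows $i-1$ and $i$ and a new zero column between columns $i-1$ and $i$ (so the new row and column have index $i$), obtaining an $m\times m$ matrix $A'$; copy the top $i-1$ entries of the last column of $A'$ into the top $i-1$ entries of the new column $i$, obtaining $A''$; finally replace the top $i$ entries of the last column of $A''$ by the top $i$ entries of the last column of $A$. The result is $\alpha(A)$. For $1\le k\le\dim(A)$, $\alpha_k(A)$ is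 the matrix obtained from $A$ by replacing the submatrix $A[k]$ by $\alpha(A[k])$ and keeping all other entries unchanged. For $A\in\mathcal{M}'_n$ with $\dim(A)=m$, define $\theta(A)=\alpha_m\circ\alpha_{m-1}\circ\cdots\circ\alpha_1(A)$. -}

module Defs where

open import Data.Bool.Base using (if_then_else_; _∧_)
open import Data.Fin.Base using (Fin; zero; suc; toℕ; fromℕ; fromℕ<; _<_)
open import Data.Fin.Properties using (_≟_; _<?_; _≤?_)
open import Data.Maybe.Base as Maybe using (Maybe; just; nothing; maybe)
open import Data.Nat.Base as ℕ using (ℕ; zero; suc)
import Data.Nat.Properties as ℕ
open import Data.Product.Base using (∃; ∃₂; _×_; _,_)
open import Data.Vec.Base using (Vec; []; _∷_; lookup; tabulate; map; sum; replicate; insertAt; truncate)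
open import Level using (0ℓ)
open import Relation.Binary.PropositionalEquality using (_≡_)
open import Relation.Nullary.Decidable using (does; yes; no)
open import Relation.Unary using (Pred)

-- A matrix is the vector of its rows.  Rows and columns are indexed by Fin m,
-- hence from 0: the index written i in the usual 1-based convention is i − 1
-- here.

Matrix : ℕ → Set
Matrix m = Vec (Vec ℕ m) m

SquareMatrix : Set
SquareMatrix = ∃ Matrix

private
  variable
    m n k p : ℕ

entry : Matrix m → Fin m → Fin m → ℕ
entry A i j = lookup (lookup A i) j

build : (Fin m → Fin m → ℕ) → Matrix m
build f = tabulate λ i → tabulate λ j → f i j

column : Matrix m → Fin m → Vec ℕ m
column A j = map (λ row → lookup row j) A

weight : Matrix m → ℕ
weight A = sum (map sum A)

leading : k ℕ.≤ m → Matrix m → Matrix k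
leading k≤m A = truncate k≤m (map (truncate k≤m) A)

UpperTriangular : Matrix m → Set
UpperTriangular A = ∀ i j → j < i → entry A i j ≡ 0

NonZeroRow : Matrix m → Fin m → Set
NonZeroRow A i = ∃ λ j → 0 ℕ.< entry A i j

NonZeroColumn : Matrix m → Fin m → Set
NonZeroColumn A j = ∃ λ i → 0 ℕ.< entry A i j

-- The smallest and the largest index of a positive entry; nothing for the
-- zero vector.

firstPositive : Vec ℕ n → Maybe (Fin n)
firstPositive []           = nothing
firstPositive (zero  ∷ xs) = Maybe.map suc (firstPositive xs)
firstPositive (suc _ ∷ xs) = just zero

lastPositive : Vec ℕ n → Maybe (Fin n)
lastPositive []           = nothing
lastPositive (zero  ∷ xs) = Maybe.map suc (lastPositive xs)
lastPositive (suc _ ∷ xs) = just (maybe suc zero (lastPositive xs))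

rmin rmax : Matrix m → Fin m → Maybe (Fin m)
rmin A j = firstPositive (column A j)
rmax A j = lastPositive (column A j)

record IsFishburn (n : ℕ) (A : Matrix m) : Set where
  field
    weight≡n        : weight A ≡ n
    upperTriangular : UpperTriangular A
    nonZeroRows     : ∀ i → NonZeroRow A i
    nonZeroColumns  : ∀ j → NonZeroColumn A j

record IsFishburn′ (n : ℕ) (A : Matrix m) : Set where
  field
    weight≡n        : weight A ≡ n
    upperTriangular : UpperTriangular A
    nonZeroColumns  : ∀ j → NonZeroColumn A j
    rmin<rmax       : ∀ j j⁺ → toℕ j⁺ ≡ suc (toℕ j) →
                      ∃₂ λ r s → rmin A j ≡ just r × rmax A j⁺ ≡ just s × r < s

𝓜 𝓜′ : ℕ → Pred SquareMatrix 0ℓ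
𝓜  n (_ , A) = IsFishburn n A
𝓜′ n (_ , A) = IsFishburn′ n A

-- Case (2) of α, for i the row of the lowest positive entry of the last
-- column, strictly above the last row.

module Move (A : Matrix (suc p)) (i : Fin (suc p)) where

  last : Fin (suc p)
  last = fromℕ p

  A′ A″ moved : Matrix (suc p)
  A′    = insertAt (map (λ row → insertAt row i 0) (leading (ℕ.n≤1+n p) A))
                   i (replicate (suc p) 0)
  A″    = build λ r c → if does (c ≟ i) ∧ does (r <? i)
                        then entry A′ r last else entry A′ r c
  moved = build λ r c → if does (c ≟ last) ∧ does (r ≤? i)
                        then entry A r c else entry A″ r c

-- α is made total by leaving A unchanged when its last column is zero.  This
-- never happens in the computation of θ on 𝓜′ n: when α is applied to the
-- leading k × k block, the last column of that block is still column k of the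
-- original upper triangular matrix.

α : Matrix (suc p) → Matrix (suc p)
α {p} A = maybe (λ i → if does (i ≟ fromℕ p) then A else Move.moved A i)
                A
                (rmax A (fromℕ p))

replaceLeading : Matrix k → Matrix m → Matrix m
replaceLeading {k} {m} B A = build f
  where
  f : Fin m → Fin m → ℕ
  f r c with toℕ r ℕ.<? k | toℕ c ℕ.<? k
  ... | yes r<k | yes c<k = entry B (fromℕ< r<k) (fromℕ< c<k)
  ... | _       | _       = entry A r c

-- For k < m this acts on the leading block of size k + 1.

αₖ : k ℕ.< m → Matrix m → Matrix m
αₖ k<m A = replaceLeading (α (leading k<m A)) A

-- The composite of the first k steps, the smallest block first.

steps : ∀ k → k ℕ.≤ m → Matrix m → Matrix m
steps zero    _   A = A
steps (suc k) k<m A = αₖ k<m (steps k (ℕ.<⇒≤ k<m) A)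

θ : SquareMatrix → SquareMatrix
θ (m , A) = m , steps m ℕ.≤-refl A

{-# OPTIONS --safe #-}

-- Induct on the dimension: θ A is α applied to the matrix X whose leading
-- block of codimension one is θ of that block of A, bordered by the last row
-- and column of A.  Such X are exactly the upper triangular matrices with
-- Fishburn leading block, nonzero last column v, and rmax v > rmin of the
-- column before, because α does not change rmin of the last column.
--
-- On these X, α is a weight-preserving bijection onto Fishburn matrices.  The
-- row i = rmax v can be recovered from B = α X: it is the first row of B whose
-- entries all vanish outside the last column.  Knowing i, the move is undone
-- entry by entry.
module Submission where

open import Defs
open import Data.Bool.Base using (if_then_else_; _∧_)
open import Data.Fin.Base
  using (Fin; zero; suc; toℕ; fromℕ; fromℕ<; inject₁; inject≤; punchIn; punchOut; _<_; _≤_)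
open import Data.Fin.Properties as Fin using (_≟_; _<?_; _≤?_)
open import Data.Fin.Relation.Unary.Top using (view; ‵fromℕ; ‵inject₁)
open import Data.Maybe.Base using (just; nothing; maybe)
open import Data.Nat.Base as ℕ using (ℕ; zero; suc; z≤n; s≤s; _+_; _≥_)
import Data.Nat.Properties as ℕ
open import Data.Product using (∃; ∃₂; Σ-syntax; _×_; _,_; proj₁; proj₂; map)
open import Data.Vec.Base as Vec using (Vec; []; _∷_; lookup; insertAt; truncate)
import Data.Vec.Properties as Vec
open import Algebra.Properties.CommutativeMonoid.Sum ℕ.+-0-commutativeMonoid
  using (sum-cong-≗; sum-init-last; sum-remove; sum-replicate-zero; ∑-distrib-+)
  renaming (sum to ∑)
open import Algebra.Properties.CommutativeSemigroup ℕ.+-commutativeSemigroup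
  using (x∙yz≈y∙xz; x∙yz≈y∙zx)
open import Function using (Bijective; _∘_; _on_)
open import Relation.Binary.Definitions using (tri<; tri≈; tri>)
open import Relation.Binary.PropositionalEquality
open import Relation.Nullary using (¬_; Dec; yes; no; does; contradiction)
open import Relation.Nullary.Decidable using (dec-true; dec-false; _×-dec_; ¬?)
open import Relation.Unary using (_∈_)

-- The inserted row and column of index `i` are called the pivot. The top of the last core column is
-- diverted into column `i`, and the top of the last column takes the vacated places. Two facts
-- follow. The inequality rmax > rmin is equivalent to column `i` of the image being nonzero: a
-- positive entry of the last core column strictly above row `i` lands there, and conversely column
-- `i` vanishes on and below the pivot row, so a positive entry in it comes from above. The pivot
-- row can be recognised because a core row above it keeps a positive entry outside the last column:
-- the only entry that might have been shifted into that column is the diverted one. The move is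
-- handled as a relation between both matrices. The same equations, read from left to right,
-- transport properties to the image and, read from right to left, to the preimage, so no inverse
-- map has to be composed with `α`. In dimension one there is no column before the last. Conditions
-- on that column are therefore guarded by an equation such as `suc (toℕ j) ≡ p`, which has no
-- solution there.

private
  variable
    m n k p q : ℕ

-- Indices

inject₁<fromℕ : (j : Fin p) → inject₁ j < fromℕ p
inject₁<fromℕ {p} j = subst (toℕ (inject₁ j) ℕ.<_) (sym (Fin.toℕ-fromℕ p)) (Fin.inject₁ℕ< j)

<⇒≢fromℕ : {i j : Fin (suc p)} → i < j → i ≢ fromℕ p
<⇒≢fromℕ {j = j} i<j refl = ℕ.<⇒≱ i<j (Fin.≤fromℕ j)

≢fromℕ⇒inject₁ : (i : Fin (suc p)) → i ≢ fromℕ p → ∃ λ j → i ≡ inject₁ j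
≢fromℕ⇒inject₁ i i≢ with view i
... | ‵fromℕ     = contradiction refl i≢
... | ‵inject₁ j = j , refl

-- After an insertion at `i`, an old index `j` is found at `punchIn i j`. Case analysis along this
-- view separates the inserted row or column from the old ones.
data PunchView (i : Fin (suc p)) : Fin (suc p) → Set where
  pivot : PunchView i i
  other : ∀ j → PunchView i (punchIn i j)

punchView : (i j : Fin (suc p)) → PunchView i j
punchView i j with i ≟ j
... | yes refl = pivot
... | no  i≢j  = subst (PunchView i) (Fin.punchIn-punchOut i≢j) (other (punchOut i≢j))

punchIn-< : (i : Fin (suc p)) (j : Fin p) → toℕ j ℕ.< toℕ i → punchIn i j ≡ inject₁ j
punchIn-< (suc i) zero    _           = refl
punchIn-< (suc i) (suc j) (s≤s j<i) = cong suc (punchIn-< i j j<i)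

punchIn-≥ : (i : Fin (suc p)) (j : Fin p) → toℕ i ℕ.≤ toℕ j → punchIn i j ≡ suc j
punchIn-≥ zero    j       _         = refl
punchIn-≥ (suc i) (suc j) (s≤s i≤j) = cong suc (punchIn-≥ i j i≤j)

punchIn<pivot : (i : Fin (suc p)) (j : Fin p) → toℕ j ℕ.< toℕ i → punchIn i j < i
punchIn<pivot i j j<i rewrite punchIn-< i j j<i | Fin.toℕ-inject₁ j = j<i

pivot<punchIn : (i : Fin (suc p)) (j : Fin p) → toℕ i ℕ.≤ toℕ j → i < punchIn i j
pivot<punchIn i j i≤j rewrite punchIn-≥ i j i≤j = s≤s i≤j

punchIn<pivot⁻¹ : (i : Fin (suc p)) (j : Fin p) → punchIn i j < i → toℕ j ℕ.< toℕ i
punchIn<pivot⁻¹ i j pj<i with toℕ j ℕ.<? toℕ i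
... | yes j<i = j<i
... | no  j≮i = contradiction (pivot<punchIn i j (ℕ.≮⇒≥ j≮i)) (ℕ.<⇒≯ pj<i)

pivot<punchIn⁻¹ : (i : Fin (suc p)) (j : Fin p) → i < punchIn i j → toℕ i ℕ.≤ toℕ j
pivot<punchIn⁻¹ i j i<pj with toℕ j ℕ.<? toℕ i
... | yes j<i = contradiction (punchIn<pivot i j j<i) (ℕ.<⇒≯ i<pj)
... | no  j≮i = ℕ.≮⇒≥ j≮i

punchIn-mono-< : (i : Fin (suc p)) {j k : Fin p} → j < k → punchIn i j < punchIn i k
punchIn-mono-< i j<k = ℕ.≰⇒> (ℕ.<⇒≱ j<k ∘ Fin.punchIn-cancel-≤ i _ _)

punchIn-cancel-< : (i : Fin (suc p)) {j k : Fin p} → punchIn i j < punchIn i k → j < k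
punchIn-cancel-< i pj<pk = ℕ.≰⇒> (ℕ.<⇒≱ pj<pk ∘ Fin.punchIn-mono-≤ i _ _)

-- Since the insertion happens before the end, the last core column is shifted onto the last column
-- of the whole matrix. This is the only place where old and new data collide.
punchIn-fromℕ : {i : Fin (suc (suc q))} → i ≢ fromℕ (suc q) → punchIn i (fromℕ q) ≡ fromℕ (suc q)
punchIn-fromℕ {q} {i} i≢ with ≢fromℕ⇒inject₁ i i≢
... | j , refl = punchIn-≥ (inject₁ j) (fromℕ q)
                   (subst (ℕ._≤ toℕ (fromℕ q)) (sym (Fin.toℕ-inject₁ j)) (Fin.≤fromℕ j))

-- Entries and extremal positive indices

entry-build : (f : Fin m → Fin m → ℕ) (r c : Fin m) → entry (build f) r c ≡ f r c
entry-build f r c =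
  trans (cong (λ row → lookup row c) (Vec.lookup∘tabulate _ r)) (Vec.lookup∘tabulate (f r) c)

matrix-ext : {A B : Matrix m} → (∀ r c → entry A r c ≡ entry B r c) → A ≡ B
matrix-ext eq = vec-ext (λ r → vec-ext (eq r))
  where
  vec-ext : ∀ {X : Set} {n} {xs ys : Vec X n} → (∀ i → lookup xs i ≡ lookup ys i) → xs ≡ ys
  vec-ext {xs = xs} {ys} eq = trans (sym (Vec.tabulate∘lookup xs))
                                    (trans (Vec.tabulate-cong eq) (Vec.tabulate∘lookup ys))

entry-leading : (k≤m : k ℕ.≤ m) (A : Matrix m) (r c : Fin k) →
                entry (leading k≤m A) r c ≡ entry A (inject≤ r k≤m) (inject≤ c k≤m)
entry-leading k≤m A r c = begin
  lookup (lookup (truncate k≤m (Vec.map (truncate k≤m) A)) r) c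
    ≡⟨ cong (λ row → lookup row c) (Vec.lookup-truncate k≤m _ r) ⟩
  lookup (lookup (Vec.map (truncate k≤m) A) (inject≤ r k≤m)) c
    ≡⟨ cong (λ row → lookup row c) (Vec.lookup-map (inject≤ r k≤m) _ A) ⟩
  lookup (truncate k≤m (lookup A (inject≤ r k≤m))) c
    ≡⟨ Vec.lookup-truncate k≤m _ c ⟩
  entry A (inject≤ r k≤m) (inject≤ c k≤m) ∎
  where open ≡-Reasoning

inject≤-inject₁ : .(p≤1+p : p ℕ.≤ suc p) (i : Fin p) → inject≤ i p≤1+p ≡ inject₁ i
inject≤-inject₁ le i = Fin.toℕ-injective (trans (Fin.toℕ-inject≤ i le) (sym (Fin.toℕ-inject₁ i)))

core : Matrix (suc p) → Matrix p
core {p} = leading (ℕ.n≤1+n p)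

entry-core : (A : Matrix (suc p)) (r c : Fin p) → entry (core A) r c ≡ entry A (inject₁ r) (inject₁ c)
entry-core {p} A r c = trans (entry-leading (ℕ.n≤1+n p) A r c)
  (cong₂ (entry A) (inject≤-inject₁ _ r) (inject≤-inject₁ _ c))

lookup-column : (A : Matrix m) (j r : Fin m) → lookup (column A j) r ≡ entry A r j
lookup-column A j r = Vec.lookup-map r _ A

lastPositive-nothing : (xs : Vec ℕ n) → lastPositive xs ≡ nothing → ∀ i → lookup xs i ≡ 0
lastPositive-nothing (zero ∷ xs) eq zero = refl
lastPositive-nothing (zero ∷ xs) eq (suc i) with lastPositive xs in eq′
... | nothing = lastPositive-nothing xs eq′ i

lastPositive-just : (xs : Vec ℕ n) {i : Fin n} → lastPositive xs ≡ just i →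
                    0 ℕ.< lookup xs i × (∀ j → i < j → lookup xs j ≡ 0)
lastPositive-just (zero ∷ xs) eq with lastPositive xs in eq′
lastPositive-just (zero ∷ xs) refl | just i =
  proj₁ (lastPositive-just xs eq′) , λ { (suc j) (s≤s i<j) → proj₂ (lastPositive-just xs eq′) j i<j }
lastPositive-just (suc _ ∷ xs) refl with lastPositive xs in eq′
... | nothing = s≤s z≤n , λ { (suc j) _ → lastPositive-nothing xs eq′ j }
... | just i  =
  proj₁ (lastPositive-just xs eq′) , λ { (suc j) (s≤s i<j) → proj₂ (lastPositive-just xs eq′) j i<j }

firstPositive-nothing : (xs : Vec ℕ n) → firstPositive xs ≡ nothing → ∀ i → lookup xs i ≡ 0
firstPositive-nothing (zero ∷ xs) eq zero = refl
firstPositive-nothing (zero ∷ xs) eq (suc i) with firstPositive xs in eq′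
... | nothing = firstPositive-nothing xs eq′ i

firstPositive-just : (xs : Vec ℕ n) {i : Fin n} → firstPositive xs ≡ just i →
                     0 ℕ.< lookup xs i × (∀ j → j < i → lookup xs j ≡ 0)
firstPositive-just (zero ∷ xs) eq with firstPositive xs in eq′
firstPositive-just (zero ∷ xs) refl | just i =
  proj₁ (firstPositive-just xs eq′) ,
  λ { zero _ → refl ; (suc j) (s≤s j<i) → proj₂ (firstPositive-just xs eq′) j j<i }
firstPositive-just (suc _ ∷ xs) refl = s≤s z≤n , λ _ ()

lastPositive-≥ : (xs : Vec ℕ n) (i : Fin n) →
                 0 ℕ.< lookup xs i → ∃ λ j → lastPositive xs ≡ just j × i ≤ j
lastPositive-≥ xs i pos with lastPositive xs in eq
... | nothing = contradiction (lastPositive-nothing xs eq i) (ℕ.>⇒≢ pos)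
... | just j  = j , refl , ℕ.≮⇒≥ λ j<i → ℕ.>⇒≢ pos (proj₂ (lastPositive-just xs eq) i j<i)

firstPositive-≤ : (xs : Vec ℕ n) (i : Fin n) →
                  0 ℕ.< lookup xs i → ∃ λ j → firstPositive xs ≡ just j × j ≤ i
firstPositive-≤ xs i pos with firstPositive xs in eq
... | nothing = contradiction (firstPositive-nothing xs eq i) (ℕ.>⇒≢ pos)
... | just j  = j , refl , ℕ.≮⇒≥ λ i<j → ℕ.>⇒≢ pos (proj₂ (firstPositive-just xs eq) i i<j)

-- This is rmin < `x`. The bound is a number and not an index, so that the same `x` serves a matrix
-- and its core.
PositiveBefore : Matrix m → Fin m → ℕ → Set
PositiveBefore A c x = ∃ λ r → toℕ r ℕ.< x × 0 ℕ.< entry A r c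

-- Equivalent to rmin j < rmax j⁺, without mentioning extremal indices.
Linked : Matrix m → Fin m → Fin m → Set
Linked A j j⁺ = ∃ λ s → PositiveBefore A j (toℕ s) × 0 ℕ.< entry A s j⁺

record IsLowest (A : Matrix m) (c i : Fin m) : Set where
  field
    positive : 0 ℕ.< entry A i c
    below    : ∀ r → i < r → entry A r c ≡ 0

rmax⇒isLowest : (A : Matrix m) {c i : Fin m} → rmax A c ≡ just i → IsLowest A c i
rmax⇒isLowest A {c} {i} eq with pos , zeros ← lastPositive-just (column A c) eq = record
  { positive = subst (0 ℕ.<_) (lookup-column A c i) pos
  ; below    = λ r i<r → trans (sym (lookup-column A c r)) (zeros r i<r)
  }

rmax-exists : (A : Matrix m) {c : Fin m} → NonZeroColumn A c → ∃ λ i → rmax A c ≡ just i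
rmax-exists A {c} (r , pos)
  with i , eq , _ ← lastPositive-≥ (column A c) r (subst (0 ℕ.<_) (sym (lookup-column A c r)) pos) = i , eq

isLowest⇒rmax : (A : Matrix m) {c i : Fin m} → IsLowest A c i → rmax A c ≡ just i
isLowest⇒rmax A {c} {i} low
  with j , eq , i≤j ← lastPositive-≥ (column A c) i
                        (subst (0 ℕ.<_) (sym (lookup-column A c i)) (IsLowest.positive low))
  with Fin.<-cmp i j
... | tri< i<j _ _ = contradiction (IsLowest.below low j i<j) (ℕ.>⇒≢ (IsLowest.positive (rmax⇒isLowest A eq)))

... | tri≈ _ refl _ = eq
... | tri> _ _ j<i = contradiction i≤j (ℕ.<⇒≱ j<i)

rmin<rmax⇒linked : (A : Matrix m) {j j⁺ : Fin m} →
  (∃₂ λ r s → rmin A j ≡ just r × rmax A j⁺ ≡ just s × r < s) → Linked A j j⁺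
rmin<rmax⇒linked A {j} (r , s , rmin≡ , rmax≡ , r<s) =
  s , (r , r<s , subst (0 ℕ.<_) (lookup-column A j r) (proj₁ (firstPositive-just (column A j) rmin≡)))
    , IsLowest.positive (rmax⇒isLowest A rmax≡)

linked⇒rmin<rmax : (A : Matrix m) {j j⁺ : Fin m} → Linked A j j⁺ →
  ∃₂ λ r s → rmin A j ≡ just r × rmax A j⁺ ≡ just s × r < s
linked⇒rmin<rmax A {j} {j⁺} (s , (r , r<s , r-pos) , s-pos)
  with r′ , rmin≡ , r′≤r ← firstPositive-≤ (column A j) r (subst (0 ℕ.<_) (sym (lookup-column A j r)) r-pos)
     | s′ , rmax≡ , s≤s′ ← lastPositive-≥ (column A j⁺) s (subst (0 ℕ.<_) (sym (lookup-column A j⁺ s)) s-pos)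
  = r′ , s′ , rmin≡ , rmax≡ , ℕ.<-≤-trans (ℕ.≤-<-trans r′≤r r<s) s≤s′

-- The move as a relation

if-∧-true : ∀ {P Q X : Set} {x y : X} (P? : Dec P) (Q? : Dec Q) → P → Q →
            (if does P? ∧ does Q? then x else y) ≡ x
if-∧-true P? Q? p q rewrite dec-true P? p | dec-true Q? q = refl

if-∧-false : ∀ {P Q X : Set} {x y : X} (P? : Dec P) (Q? : Dec Q) → ¬ (P × Q) →
             (if does P? ∧ does Q? then x else y) ≡ y
if-∧-false (yes p) (yes q) ¬pq = contradiction (p , q) ¬pq
if-∧-false (yes p) (no _)  ¬pq = refl
if-∧-false (no _)  _       ¬pq = refl

-- B is Move.moved A i, as a relation that can be read in both directions.
record Moves (A : Matrix (suc (suc q))) (i : Fin (suc (suc q))) (B : Matrix (suc (suc q))) : Set where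
  field
    pivot-row    : ∀ c → c ≢ fromℕ (suc q) → entry B i c ≡ 0
    last-column  : ∀ r → r ≤ i → entry B r (fromℕ (suc q)) ≡ entry A r (fromℕ (suc q))
    block        : ∀ r c → (c ≡ fromℕ q → toℕ i ℕ.≤ toℕ r) →
                   entry B (punchIn i r) (punchIn i c) ≡ entry A (inject₁ r) (inject₁ c)
    column-above : ∀ r → toℕ r ℕ.< toℕ i → entry B (punchIn i r) i ≡ entry A (inject₁ r) (inject₁ (fromℕ q))
    column-below : ∀ r → toℕ i ℕ.≤ toℕ r → entry B (punchIn i r) i ≡ 0

module _ (A : Matrix (suc (suc q))) (i : Fin (suc (suc q))) (i≢last : i ≢ fromℕ (suc q)) where
  open Move A i

  private
    A′-pivot-row : ∀ c → entry A′ i c ≡ 0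
    A′-pivot-row c =
      trans (cong (λ row → lookup row c) (Vec.insertAt-lookup _ i _)) (Vec.lookup-replicate c 0)

    A′-row : ∀ r c → entry A′ (punchIn i r) c ≡ lookup (insertAt (lookup (core A) r) i 0) c
    A′-row r c = cong (λ row → lookup row c)
      (trans (Vec.insertAt-punchIn _ i _ r) (Vec.lookup-map r _ (core A)))

    A′-pivot-column : ∀ r → entry A′ (punchIn i r) i ≡ 0
    A′-pivot-column r = trans (A′-row r i) (Vec.insertAt-lookup (lookup (core A) r) i 0)

    A′-block : ∀ r c → entry A′ (punchIn i r) (punchIn i c) ≡ entry A (inject₁ r) (inject₁ c)
    A′-block r c = trans (A′-row r _)
      (trans (Vec.insertAt-punchIn (lookup (core A) r) i 0 c) (entry-core A r c))

    A″-entry moved-entry : Fin (suc (suc q)) → Fin (suc (suc q)) → ℕ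
    A″-entry    r c = if does (c ≟ i) ∧ does (r <? i) then entry A′ r last else entry A′ r c
    moved-entry r c = if does (c ≟ last) ∧ does (r ≤? i) then entry A r c else entry A″ r c

    A″-copied : ∀ r → r < i → entry A″ r i ≡ entry A′ r last
    A″-copied r r<i = trans (entry-build A″-entry r i) (if-∧-true (i ≟ i) (r <? i) refl r<i)

    A″-kept : ∀ r c → ¬ (c ≡ i × r < i) → entry A″ r c ≡ entry A′ r c
    A″-kept r c ¬p = trans (entry-build A″-entry r c) (if-∧-false (c ≟ i) (r <? i) ¬p)

    moved-replaced : ∀ r → r ≤ i → entry moved r last ≡ entry A r last
    moved-replaced r r≤i =
      trans (entry-build moved-entry r last) (if-∧-true (last ≟ last) (r ≤? i) refl r≤i)

    moved-kept : ∀ r c → ¬ (c ≡ last × r ≤ i) → entry moved r c ≡ entry A″ r c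
    moved-kept r c ¬p = trans (entry-build moved-entry r c) (if-∧-false (c ≟ last) (r ≤? i) ¬p)

  moved-moves : Moves A i moved
  moved-moves = record
    { pivot-row    = λ c c≢last → trans (moved-kept i c λ (c≡last , _) → c≢last c≡last)
                       (trans (A″-kept i c λ (_ , i<i) → ℕ.<-irrefl refl i<i) (A′-pivot-row c))
    ; last-column  = moved-replaced
    -- Only a shifted last core column can be overwritten, and only down to row `i`; for that column
    -- `h` places the row strictly below the pivot.
    ; block        = λ r c h → trans (moved-kept (punchIn i r) (punchIn i c) λ (pc≡last , pr≤i) →
                         ℕ.<⇒≱ (pivot<punchIn i r (h (Fin.punchIn-injective i c (fromℕ q)
                           (trans pc≡last (sym (punchIn-fromℕ i≢last)))))) pr≤i)
                       (trans (A″-kept (punchIn i r) (punchIn i c) λ (pc≡i , _) → Fin.punchInᵢ≢i i c pc≡i) (A′-block r c))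
    ; column-above = λ r r<i → begin
        entry moved (punchIn i r) i              ≡⟨ moved-kept (punchIn i r) i (i≢last ∘ proj₁) ⟩
        entry A″ (punchIn i r) i                 ≡⟨ A″-copied (punchIn i r) (punchIn<pivot i r r<i) ⟩
        entry A′ (punchIn i r) last              ≡⟨ cong (entry A′ (punchIn i r)) (punchIn-fromℕ i≢last) ⟨
        entry A′ (punchIn i r) (punchIn i (fromℕ q)) ≡⟨ A′-block r (fromℕ q) ⟩
        entry A (inject₁ r) (inject₁ (fromℕ q))  ∎
    ; column-below = λ r i≤r → trans (moved-kept (punchIn i r) i (i≢last ∘ proj₁))
                       (trans (A″-kept (punchIn i r) i λ (_ , pr<i) → ℕ.<⇒≱ (punchIn<pivot⁻¹ i r pr<i) i≤r)
                              (A′-pivot-column r))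
    }
    where open ≡-Reasoning

moves-functional : {A B B′ : Matrix (suc (suc q))} {i : Fin (suc (suc q))} → i ≢ fromℕ (suc q) →
                   Moves A i B → Moves A i B′ → B ≡ B′
moves-functional {q} {A} {B} {B′} {i} i≢last mv mv′ = matrix-ext go
  where
  module M  = Moves mv
  module M′ = Moves mv′
  at-last : ∀ r → r ≤ i → entry B r (fromℕ (suc q)) ≡ entry B′ r (fromℕ (suc q))
  at-last r r≤i = trans (M.last-column r r≤i) (sym (M′.last-column r r≤i))
  in-block : ∀ r c → (c ≡ fromℕ q → toℕ i ℕ.≤ toℕ r) →
             entry B (punchIn i r) (punchIn i c) ≡ entry B′ (punchIn i r) (punchIn i c)
  in-block r c h = trans (M.block r c h) (sym (M′.block r c h))
  go : ∀ r c → entry B r c ≡ entry B′ r c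
  go r c with punchView i r
  go r c | pivot with c ≟ fromℕ (suc q)
  ... | yes refl   = at-last i ℕ.≤-refl
  ... | no  c≢last = trans (M.pivot-row c c≢last) (sym (M′.pivot-row c c≢last))
  go r c | other r′ with toℕ r′ ℕ.<? toℕ i | punchView i c
  ... | yes r′<i | pivot = trans (M.column-above r′ r′<i) (sym (M′.column-above r′ r′<i))
  ... | no  r′≮i | pivot = trans (M.column-below r′ (ℕ.≮⇒≥ r′≮i)) (sym (M′.column-below r′ (ℕ.≮⇒≥ r′≮i)))
  ... | no  r′≮i | other c′ = in-block r′ c′ λ _ → ℕ.≮⇒≥ r′≮i
  ... | yes r′<i | other c′ with c′ ≟ fromℕ q
  ...   | no  c′≢ = in-block r′ c′ λ c′≡ → contradiction c′≡ c′≢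
  -- These are the positions excluded from `block`: they lie in the last column above the pivot and
  -- are governed by `last-column`.
  ...   | yes refl rewrite punchIn-fromℕ i≢last = at-last (punchIn i r′) (ℕ.<⇒≤ (punchIn<pivot i r′ r′<i))

-- The entries of A that Moves A i B leaves undetermined.
record Reduced (A : Matrix (suc p)) (i : Fin (suc p)) : Set where
  field
    last-row : ∀ c → entry A (fromℕ p) (inject₁ c) ≡ 0
    below    : ∀ r → i < r → entry A r (fromℕ p) ≡ 0

moves-injective : {A A′ B : Matrix (suc (suc q))} {i : Fin (suc (suc q))} →
                  Reduced A i → Reduced A′ i → Moves A i B → Moves A′ i B → A ≡ A′
moves-injective {q} {A} {A′} {B} {i} red red′ mv mv′ = matrix-ext go
  where
  module M  = Moves mv
  module M′ = Moves mv′
  module R  = Reduced red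
  module R′ = Reduced red′
  go : ∀ r c → entry A r c ≡ entry A′ r c
  go r c with view c
  go r _ | ‵fromℕ with r ≤? i
  ... | yes r≤i = trans (sym (M.last-column r r≤i)) (M′.last-column r r≤i)
  ... | no  r≰i = trans (R.below r (ℕ.≰⇒> r≰i)) (sym (R′.below r (ℕ.≰⇒> r≰i)))
  go r _ | ‵inject₁ c with view r
  ... | ‵fromℕ = trans (R.last-row c) (sym (R′.last-row c))
  ... | ‵inject₁ r′ with c ≟ fromℕ q | toℕ r′ ℕ.<? toℕ i
  ...   | yes refl | yes r′<i = trans (sym (M.column-above r′ r′<i)) (M′.column-above r′ r′<i)
  ...   | yes _ | no r′≮i = trans (sym (M.block r′ c λ _ → ℕ.≮⇒≥ r′≮i)) (M′.block r′ c λ _ → ℕ.≮⇒≥ r′≮i)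
  ...   | no c≢ | _ = trans (sym (M.block r′ c λ c≡ → contradiction c≡ c≢))
                            (M′.block r′ c λ c≡ → contradiction c≡ c≢)

-- Recognising the pivot row, and the domain of the move

record IsPivot (B : Matrix (suc p)) (i : Fin (suc p)) : Set where
  field
    zero-row : ∀ c → c ≢ fromℕ p → entry B i c ≡ 0
    above    : ∀ r → r < i → ∃ λ c → c ≢ fromℕ p × 0 ℕ.< entry B r c

isPivot-unique : {B : Matrix (suc p)} {i j : Fin (suc p)} → IsPivot B i → IsPivot B j → i ≡ j
isPivot-unique {i = i} {j} Pi Pj with Fin.<-cmp i j
... | tri≈ _ i≡j _ = i≡j
... | tri< i<j _ _ with c , c≢ , pos ← IsPivot.above Pj i i<j =
  contradiction (IsPivot.zero-row Pi c c≢) (ℕ.>⇒≢ pos)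
... | tri> _ _ j<i with c , c≢ , pos ← IsPivot.above Pi j j<i =
  contradiction (IsPivot.zero-row Pj c c≢) (ℕ.>⇒≢ pos)

-- The Fishburn conditions without the weight, which differs from one leading block to the next in
-- the induction.
record Admissible (A : Matrix m) : Set where
  field
    upper   : UpperTriangular A
    rows    : ∀ i → NonZeroRow A i
    columns : ∀ j → NonZeroColumn A j

-- By triangularity the last row vanishes outside the last column, so the search for the first such
-- row succeeds.
isPivot-exists : (B : Matrix (suc p)) → UpperTriangular B → ∃ (IsPivot B)
isPivot-exists {p} B upper
  with i , ¬P , above ← Fin.¬∀⟶∃¬-smallest (suc p) (λ r → ∃ λ c → c ≢ fromℕ p × 0 ℕ.< entry B r c)
         (λ r → Fin.any? λ c → ¬? (c ≟ fromℕ p) ×-dec (0 ℕ.<? entry B r c))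
         (λ all → let c , c≢ , pos = all (fromℕ p) in
           ℕ.>⇒≢ pos (upper (fromℕ p) c (Fin.≤∧≢⇒< (Fin.≤fromℕ c) c≢)))
  = i , record
    { zero-row = λ c c≢ → ℕ.n≤0⇒n≡0 (ℕ.≮⇒≥ λ pos → ¬P (c , c≢ , pos))
    ; above    = λ r r<i → subst (λ r → ∃ λ c → c ≢ fromℕ p × 0 ℕ.< entry B r c)
                   (Fin.toℕ-injective (trans (Fin.toℕ-inject {i = i} _) (Fin.toℕ-fromℕ< r<i)))
                   (above (fromℕ< r<i))
    }

-- The domain on which α is a bijection onto the Fishburn matrices.
record Prepared (A : Matrix (suc p)) : Set where
  field
    upper       : UpperTriangular A
    core-adm    : Admissible (core A)
    last-column : NonZeroColumn A (fromℕ p)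
    linked      : ∀ j → suc (toℕ j) ≡ p → Linked A (inject₁ j) (fromℕ p)

reduced : {A : Matrix (suc p)} {i : Fin (suc p)} → UpperTriangular A → IsLowest A (fromℕ p) i → Reduced A i
reduced {p} upper low = record
  { last-row = λ c → upper (fromℕ p) (inject₁ c) (inject₁<fromℕ c)
  ; below    = IsLowest.below low
  }

inject₁-mono-< : {i j : Fin p} → i < j → inject₁ i < inject₁ j
inject₁-mono-< {i = i} {j} i<j rewrite Fin.toℕ-inject₁ i | Fin.toℕ-inject₁ j = i<j

inject₁-cancel-< : {i j : Fin p} → inject₁ i < inject₁ j → i < j
inject₁-cancel-< {i = i} {j} i<j rewrite Fin.toℕ-inject₁ i | Fin.toℕ-inject₁ j = i<j

inject₁≢fromℕ : (j : Fin p) → inject₁ j ≢ fromℕ p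
inject₁≢fromℕ j = Fin.fromℕ≢inject₁ ∘ sym

punchIn≢fromℕ : {i : Fin (suc (suc q))} (j : Fin (suc q)) → i ≢ fromℕ (suc q) → j ≢ fromℕ q →
                punchIn i j ≢ fromℕ (suc q)
punchIn≢fromℕ {q} {i} j i≢ j≢ eq =
  j≢ (Fin.punchIn-injective i j (fromℕ q) (trans eq (sym (punchIn-fromℕ i≢))))

-- The local function of replaceLeading has no name; solving the metavariable
-- against build recovers it.
private
  replaceLeading-function : (B : Matrix k) (A : Matrix m) → ∃ λ f → replaceLeading B A ≡ build f
  replaceLeading-function B A = _ , refl

  replaceLeading-function-inside : (B : Matrix k) (A : Matrix m) (r c : Fin m)
    (r<k : toℕ r ℕ.< k) (c<k : toℕ c ℕ.< k) →
    proj₁ (replaceLeading-function B A) r c ≡ entry B (fromℕ< r<k) (fromℕ< c<k)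
  replaceLeading-function-inside {k} B A r c r<k c<k with toℕ r ℕ.<? k | toℕ c ℕ.<? k
  ... | yes _  | yes _  = refl
  ... | no r≮k | _      = contradiction r<k r≮k
  ... | yes _  | no c≮k = contradiction c<k c≮k

  replaceLeading-function-outside : (B : Matrix k) (A : Matrix m) (r c : Fin m) →
    ¬ (toℕ r ℕ.< k × toℕ c ℕ.< k) → proj₁ (replaceLeading-function B A) r c ≡ entry A r c
  replaceLeading-function-outside {k} B A r c ¬p with toℕ r ℕ.<? k | toℕ c ℕ.<? k
  ... | yes r<k | yes c<k = contradiction (r<k , c<k) ¬p
  ... | no _    | _       = refl
  ... | yes _   | no _    = refl

replaceLeading-inside : (B : Matrix k) (A : Matrix m) (r c : Fin m)
  (r<k : toℕ r ℕ.< k) (c<k : toℕ c ℕ.< k) →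
  entry (replaceLeading B A) r c ≡ entry B (fromℕ< r<k) (fromℕ< c<k)
replaceLeading-inside B A r c r<k c<k =
  trans (entry-build (proj₁ (replaceLeading-function B A)) r c)
        (replaceLeading-function-inside B A r c r<k c<k)

replaceLeading-outside : (B : Matrix k) (A : Matrix m) (r c : Fin m) →
  ¬ (toℕ r ℕ.< k × toℕ c ℕ.< k) → entry (replaceLeading B A) r c ≡ entry A r c
replaceLeading-outside B A r c ¬p =
  trans (entry-build (proj₁ (replaceLeading-function B A)) r c)
        (replaceLeading-function-outside B A r c ¬p)

fromℕ<-inject₁ : (i : Fin p) (lt : toℕ (inject₁ i) ℕ.< p) → fromℕ< lt ≡ i
fromℕ<-inject₁ i lt = Fin.toℕ-injective (trans (Fin.toℕ-fromℕ< lt) (Fin.toℕ-inject₁ i))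

replaceLeading-core : (C : Matrix p) (A : Matrix (suc p)) (r c : Fin p) →
                      entry (replaceLeading C A) (inject₁ r) (inject₁ c) ≡ entry C r c
replaceLeading-core C A r c = trans
  (replaceLeading-inside C A (inject₁ r) (inject₁ c) (Fin.inject₁ℕ< r) (Fin.inject₁ℕ< c))
  (cong₂ (entry C) (fromℕ<-inject₁ r (Fin.inject₁ℕ< r)) (fromℕ<-inject₁ c (Fin.inject₁ℕ< c)))

replaceLeading-last-column : (C : Matrix p) (A : Matrix (suc p)) (r : Fin (suc p)) →
                             entry (replaceLeading C A) r (fromℕ p) ≡ entry A r (fromℕ p)
replaceLeading-last-column {p} C A r =
  replaceLeading-outside C A r (fromℕ p) λ (_ , lt) → ℕ.<-irrefl (Fin.toℕ-fromℕ p) lt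

replaceLeading-last-row : (C : Matrix p) (A : Matrix (suc p)) (c : Fin (suc p)) →
                          entry (replaceLeading C A) (fromℕ p) c ≡ entry A (fromℕ p) c
replaceLeading-last-row {p} C A c =
  replaceLeading-outside C A (fromℕ p) c λ (lt , _) → ℕ.<-irrefl (Fin.toℕ-fromℕ p) lt

core-replaceLeading : (C : Matrix p) (A : Matrix (suc p)) → core (replaceLeading C A) ≡ C
core-replaceLeading C A = matrix-ext λ r c →
  trans (entry-core (replaceLeading C A) r c) (replaceLeading-core C A r c)

-- Weights

sum-lookup : (xs : Vec ℕ n) → Vec.sum xs ≡ ∑ (lookup xs)
sum-lookup []       = refl
sum-lookup (x ∷ xs) = cong (x +_) (sum-lookup xs)

weight-∑ : (A : Matrix m) → weight A ≡ ∑ λ r → ∑ (entry A r)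
weight-∑ A = trans (sum-lookup (Vec.map Vec.sum A))
  (sum-cong-≗ λ r → trans (Vec.lookup-map r Vec.sum A) (sum-lookup (lookup A r)))

∑-zero : {f : Fin n → ℕ} → (∀ i → f i ≡ 0) → ∑ f ≡ 0
∑-zero {n} eq = trans (sum-cong-≗ eq) (sum-replicate-zero n)

-- Triangularity leaves only the corner entry in the last row, and the last column already counts
-- it.
weight-core : (A : Matrix (suc p)) → UpperTriangular A →
              weight A ≡ weight (core A) + ∑ λ r → entry A r (fromℕ p)
weight-core {p} A upper = begin
  weight A
    ≡⟨ weight-∑ A ⟩
  ∑ (λ r → ∑ (entry A r))
    ≡⟨ sum-cong-≗ (λ r → sum-init-last (entry A r)) ⟩
  ∑ (λ r → ∑ (λ c → entry A r (inject₁ c)) + entry A r (fromℕ p))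
    ≡⟨ ∑-distrib-+ (λ r → ∑ (λ c → entry A r (inject₁ c))) (λ r → entry A r (fromℕ p)) ⟩
  ∑ (λ r → ∑ (λ c → entry A r (inject₁ c))) + v
    ≡⟨ cong (_+ v) (sum-init-last (λ r → ∑ (λ c → entry A r (inject₁ c)))) ⟩
  ∑ (λ r → ∑ (λ c → entry A (inject₁ r) (inject₁ c))) + ∑ (λ c → entry A (fromℕ p) (inject₁ c)) + v
    ≡⟨ cong₂ (λ x y → x + y + v)
         (sum-cong-≗ λ r → sum-cong-≗ λ c → sym (entry-core A r c))
         (∑-zero λ c → upper (fromℕ p) (inject₁ c) (inject₁<fromℕ c)) ⟩
  ∑ (λ r → ∑ (entry (core A) r)) + 0 + v
    ≡⟨ cong (_+ v) (trans (ℕ.+-identityʳ (∑ λ r → ∑ (entry (core A) r))) (sym (weight-∑ (core A)))) ⟩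
  weight (core A) + v ∎
  where
  open ≡-Reasoning
  v = ∑ λ r → entry A r (fromℕ p)

-- Properties transported along the move

module Forward {A B : Matrix (suc (suc q))} {i : Fin (suc (suc q))} (i≢last : i ≢ fromℕ (suc q))
               (upper : UpperTriangular A) (low : IsLowest A (fromℕ (suc q)) i) (mv : Moves A i B) where
  open Moves mv
  open IsLowest low using (positive; below)
  open ≡-Reasoning

  private
    last : Fin (suc (suc q))
    last = fromℕ (suc q)

  -- Above the pivot the last core entry moves to column `i` and the entry of the old last column
  -- joins the row. Below the pivot the core row is merely shifted, and the extra summand is zero
  -- because `i` is the lowest positive row.
  row-sum : ∀ r → ∑ (entry B (punchIn i r)) ≡ ∑ (entry (core A) r) + entry A (punchIn i r) last
  row-sum r = begin
    ∑ (entry B (punchIn i r))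
      ≡⟨ sum-remove {i = i} (entry B (punchIn i r)) ⟩
    b + ∑ (λ c → entry B (punchIn i r) (punchIn i c))
      ≡⟨ cong (b +_) (sum-init-last λ c → entry B (punchIn i r) (punchIn i c)) ⟩
    b + (∑ (λ c → entry B (punchIn i r) (punchIn i (inject₁ c))) + d)
      ≡⟨ cong (λ x → b + (x + d)) (sum-cong-≗ λ c → trans
           (block r (inject₁ c) λ eq → contradiction eq (inject₁≢fromℕ c)) (sym (entry-core A r (inject₁ c)))) ⟩
    b + (s + d)
      ≡⟨ x∙yz≈y∙zx b s d ⟩
    s + (d + b)
      ≡⟨ cong (s +_) exchange ⟩
    s + (entry (core A) r (fromℕ q) + entry A (punchIn i r) last)
      ≡⟨ ℕ.+-assoc s _ _ ⟨
    s + entry (core A) r (fromℕ q) + entry A (punchIn i r) last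
      ≡⟨ cong (_+ entry A (punchIn i r) last) (sum-init-last (entry (core A) r)) ⟨
    ∑ (entry (core A) r) + entry A (punchIn i r) last ∎
    where
    b = entry B (punchIn i r) i
    d = entry B (punchIn i r) (punchIn i (fromℕ q))
    s = ∑ λ c → entry (core A) r (inject₁ c)
    exchange : d + b ≡ entry (core A) r (fromℕ q) + entry A (punchIn i r) last
    exchange with toℕ r ℕ.<? toℕ i
    ... | yes r<i = trans (ℕ.+-comm d b) (cong₂ _+_
            (trans (column-above r r<i) (sym (entry-core A r (fromℕ q))))
            (trans (cong (entry B (punchIn i r)) (punchIn-fromℕ i≢last))
                   (last-column (punchIn i r) (ℕ.<⇒≤ (punchIn<pivot i r r<i)))))
    ... | no  r≮i = cong₂ _+_
            (trans (block r (fromℕ q) λ _ → i≤r) (sym (entry-core A r (fromℕ q))))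
            (trans (column-below r i≤r) (sym (below (punchIn i r) (pivot<punchIn i r i≤r))))
      where i≤r = ℕ.≮⇒≥ r≮i

  moves-weight : weight B ≡ weight A
  moves-weight = begin
    weight B
      ≡⟨ weight-∑ B ⟩
    ∑ (λ r → ∑ (entry B r))
      ≡⟨ sum-remove {i = i} (λ r → ∑ (entry B r)) ⟩
    ∑ (entry B i) + ∑ (λ r → ∑ (entry B (punchIn i r)))
      ≡⟨ cong₂ _+_ pivot-sum (trans (sum-cong-≗ row-sum)
                                      (∑-distrib-+ (λ r → ∑ (entry (core A) r)) (v ∘ punchIn i))) ⟩
    v i + (∑ (λ r → ∑ (entry (core A) r)) + ∑ (v ∘ punchIn i))
      ≡⟨ cong (λ x → v i + (x + ∑ (v ∘ punchIn i))) (weight-∑ (core A)) ⟨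
    v i + (weight (core A) + ∑ (v ∘ punchIn i))
      ≡⟨ x∙yz≈y∙xz (v i) (weight (core A)) (∑ (v ∘ punchIn i)) ⟩
    weight (core A) + (v i + ∑ (v ∘ punchIn i))
      ≡⟨ cong (weight (core A) +_) (sum-remove {i = i} v) ⟨
    weight (core A) + ∑ v
      ≡⟨ weight-core A upper ⟨
    weight A ∎
    where
    v : Fin (suc (suc q)) → ℕ
    v r = entry A r last
    pivot-sum : ∑ (entry B i) ≡ v i
    pivot-sum = trans (sum-init-last (entry B i))
      (cong₂ _+_ (∑-zero λ c → pivot-row (inject₁ c) (inject₁≢fromℕ c)) (last-column i ℕ.≤-refl))

  -- The last column is unchanged down to row `i` and positive in row `i`, so its first positive
  -- entry stays in place whatever is shifted in below.
  moves-before⁺ : ∀ x → PositiveBefore A last x → PositiveBefore B last x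
  moves-before⁺ x (r , r<x , pos) = r , r<x ,
    subst (0 ℕ.<_) (sym (last-column r (ℕ.≮⇒≥ λ i<r → ℕ.>⇒≢ pos (below r i<r)))) pos

  moves-before⁻ : ∀ x → PositiveBefore B last x → PositiveBefore A last x
  moves-before⁻ x (r , r<x , pos) with r ≤? i
  ... | yes r≤i = r , r<x , subst (0 ℕ.<_) (last-column r r≤i) pos
  -- A witness below the pivot may be new, but row `i` is an earlier witness in `A`.
  ... | no  r≰i = i , ℕ.<-trans (ℕ.≰⇒> r≰i) r<x , positive

  module _ (adm : Admissible (core A)) where
    open Admissible adm using (rows; columns)

    private
      -- A positive core entry is either diverted to column `i` or shifted along with a column other
      -- than the last core column; both times it avoids the last column.
      above-witness : ∀ r → toℕ r ℕ.< toℕ i → ∃ λ c → c ≢ last × 0 ℕ.< entry B (punchIn i r) c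
      above-witness r r<i with c , pos ← rows r with c ≟ fromℕ q
      ... | yes refl = i , i≢last , subst (0 ℕ.<_)
              (trans (entry-core A r c) (sym (column-above r r<i))) pos
      ... | no  c≢   = punchIn i c , punchIn≢fromℕ c i≢last c≢ , subst (0 ℕ.<_)
              (trans (entry-core A r c) (sym (block r c λ c≡ → contradiction c≡ c≢))) pos

    moves-isPivot : IsPivot B i
    moves-isPivot = record { zero-row = pivot-row ; above = go }
      where
      go : ∀ r → r < i → ∃ λ c → c ≢ last × 0 ℕ.< entry B r c
      go r r<i with punchView i r
      ... | pivot    = contradiction r<i (ℕ.<-irrefl refl)
      ... | other r′ = above-witness r′ (punchIn<pivot⁻¹ i r′ r<i)

    moves-admissible : Linked A (inject₁ (fromℕ q)) last → Admissible B
    moves-admissible (s , (r , r<s , r-pos) , s-pos) = record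
      { upper = upperB ; rows = rowsB ; columns = columnsB }
      where
      s≤i : s ≤ i
      s≤i = ℕ.≮⇒≥ λ i<s → ℕ.>⇒≢ s-pos (below s i<s)

      pivot-positive : 0 ℕ.< entry B i last
      pivot-positive = subst (0 ℕ.<_) (sym (last-column i ℕ.≤-refl)) positive

      upperB : UpperTriangular B
      upperB r c c<r with punchView i r
      ... | pivot    = pivot-row c (<⇒≢fromℕ c<r)
      ... | other r′ with punchView i c
      ...   | pivot    = column-below r′ (pivot<punchIn⁻¹ i r′ c<r)
      -- The exception in `block` cannot occur: an index strictly below another one is not the last.
      ...   | other c′ = trans (block r′ c′ λ c′≡ → contradiction c′≡ (<⇒≢fromℕ c′<r′))
                               (upper (inject₁ r′) (inject₁ c′) (inject₁-mono-< c′<r′))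
        where c′<r′ = punchIn-cancel-< i c<r

      rowsB : ∀ r → NonZeroRow B r
      rowsB r with punchView i r
      ... | pivot    = last , pivot-positive
      ... | other r′ with toℕ r′ ℕ.<? toℕ i
      ...   | yes r′<i with c , _ , pos ← above-witness r′ r′<i = c , pos
      ...   | no  r′≮i with c , pos ← rows r′ = punchIn i c , subst (0 ℕ.<_)
                (trans (entry-core A r′ c) (sym (block r′ c λ _ → ℕ.≮⇒≥ r′≮i))) pos

      columnsB : ∀ c → NonZeroColumn B c
      columnsB c with punchView i c
      -- Here the link is spent: its row `r` satisfies `r < s ≤ i`, so the positive entry of the
      -- last core column is diverted into the new column.
      ... | pivot with r′ , refl ← ≢fromℕ⇒inject₁ r (<⇒≢fromℕ r<s) =
        punchIn i r′ , subst (0 ℕ.<_) (sym (column-above r′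
          (subst (ℕ._< toℕ i) (Fin.toℕ-inject₁ r′) (ℕ.<-≤-trans r<s s≤i)))) r-pos
      ... | other c′ with c′ ≟ fromℕ q
      ...   | yes refl rewrite punchIn-fromℕ i≢last = i , pivot-positive
      ...   | no  c′≢ with r′ , pos ← columns c′ = punchIn i r′ , subst (0 ℕ.<_)
                (trans (entry-core A r′ c′) (sym (block r′ c′ λ c′≡ → contradiction c′≡ c′≢))) pos

-- Undoing the move on a Fishburn matrix

module Backward {A B : Matrix (suc (suc q))} {i : Fin (suc (suc q))} (i≢last : i ≢ fromℕ (suc q))
                (adm : Admissible B) (piv : IsPivot B i) (red : Reduced A i) (mv : Moves A i B) where
  open Moves mv
  open Reduced red
  open Admissible adm renaming (upper to upperB; rows to rowsB; columns to columnsB)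
  open IsPivot piv

  private
    last : Fin (suc (suc q))
    last = fromℕ (suc q)

    upperA : UpperTriangular A
    upperA r c c<r with ≢fromℕ⇒inject₁ c (<⇒≢fromℕ c<r) | view r
    ... | c′ , refl | ‵fromℕ     = last-row c′
    ... | c′ , refl | ‵inject₁ r′ = trans
      (sym (block r′ c′ λ c′≡ → contradiction c′≡ (<⇒≢fromℕ c′<r′)))
      (upperB (punchIn i r′) (punchIn i c′) (punchIn-mono-< i c′<r′))
      where c′<r′ = inject₁-cancel-< c<r

    pivot-positive : 0 ℕ.< entry A i last
    pivot-positive with c , pos ← rowsB i with c ≟ last
    ... | yes refl = subst (0 ℕ.<_) (last-column i ℕ.≤-refl) pos
    ... | no  c≢   = contradiction (zero-row c c≢) (ℕ.>⇒≢ pos)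

    -- Above the pivot, a witness outside the last column is needed, since an entry in that column
    -- belongs to the border of `A`. Below the pivot any witness works, because column `i` is zero
    -- there.
    rowsA : ∀ r → NonZeroRow (core A) r
    rowsA r with toℕ r ℕ.<? toℕ i
    ... | yes r<i with c , c≢ , pos ← above (punchIn i r) (punchIn<pivot i r r<i) with punchView i c
    ...   | pivot    = fromℕ q , subst (0 ℕ.<_) (trans (column-above r r<i) (sym (entry-core A r _))) pos
    ...   | other c′ = c′ , subst (0 ℕ.<_)
            (trans (block r c′ λ { refl → contradiction (punchIn-fromℕ i≢last) c≢ })
                   (sym (entry-core A r _))) pos
    rowsA r | no r≮i with c , pos ← rowsB (punchIn i r) with punchView i c
    ...   | pivot    = contradiction (column-below r (ℕ.≮⇒≥ r≮i)) (ℕ.>⇒≢ pos)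
    ...   | other c′ = c′ , subst (0 ℕ.<_) (trans (block r c′ λ _ → ℕ.≮⇒≥ r≮i) (sym (entry-core A r _))) pos

    columnsA : ∀ c → NonZeroColumn (core A) c
    columnsA c with c ≟ fromℕ q
    -- The last row of a Fishburn matrix forces its corner to be positive; as the pivot lies higher,
    -- that corner is the shifted corner of the core.
    ... | yes refl with c′ , pos ← rowsB last with Fin.<-cmp c′ last
    ...   | tri< c′<last _ _ = contradiction (upperB last c′ c′<last) (ℕ.>⇒≢ pos)
    ...   | tri> _ _ last<c′ = contradiction (Fin.≤fromℕ c′) (ℕ.<⇒≱ last<c′)
    ...   | tri≈ _ refl _    = fromℕ q , subst (0 ℕ.<_) (trans
            (trans (cong₂ (entry B) (sym (punchIn-fromℕ i≢last)) (sym (punchIn-fromℕ i≢last)))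
                   (block (fromℕ q) (fromℕ q) λ _ → i≤q))
            (sym (entry-core A (fromℕ q) (fromℕ q)))) pos
      where
      i≤q : toℕ i ℕ.≤ toℕ (fromℕ q)
      i≤q = ℕ.s≤s⁻¹ (Fin.≤∧≢⇒< (Fin.≤fromℕ i) i≢last)
    columnsA c | no c≢ with r , pos ← columnsB (punchIn i c) with punchView i r
    ...   | pivot    = contradiction (zero-row _ (punchIn≢fromℕ c i≢last c≢)) (ℕ.>⇒≢ pos)
    ...   | other r′ = r′ , subst (0 ℕ.<_)
            (trans (block r′ c λ c≡ → contradiction c≡ c≢) (sym (entry-core A r′ c))) pos

    -- Column `i` is nonzero, and it vanishes on and below the pivot row. Its witness thus lies
    -- above and originates in the last core column, while row `i` itself is positive in the last
    -- column.
    linkedA : Linked A (inject₁ (fromℕ q)) last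
    linkedA with r , pos ← columnsB i with punchView i r
    ... | pivot    = contradiction (zero-row i i≢last) (ℕ.>⇒≢ pos)
    ... | other r′ with toℕ r′ ℕ.<? toℕ i
    ...   | no  r′≮i = contradiction (column-below r′ (ℕ.≮⇒≥ r′≮i)) (ℕ.>⇒≢ pos)
    ...   | yes r′<i = i , (inject₁ r′ , subst (ℕ._< toℕ i) (sym (Fin.toℕ-inject₁ r′)) r′<i
                            , subst (0 ℕ.<_) (column-above r′ r′<i) pos) , pivot-positive

  isLowest : IsLowest A last i
  isLowest = record { positive = pivot-positive ; below = below }

  prepared : Prepared A
  prepared = record
    { upper       = upperA
    ; core-adm    = record
        { upper   = λ r c c<r → trans (entry-core A r c) (upperA (inject₁ r) (inject₁ c) (inject₁-mono-< c<r))
        ; rows    = rowsA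
        ; columns = columnsA
        }
    ; last-column = i , pivot-positive
    ; linked      = λ j 1+j≡ → subst (λ j → Linked A (inject₁ j) last)
        (Fin.toℕ-injective (trans (Fin.toℕ-fromℕ q) (sym (ℕ.suc-injective 1+j≡)))) linkedA
    }

module _ (B : Matrix (suc (suc q))) (i : Fin (suc (suc q))) where

  private
    last : Fin (suc (suc q))
    last = fromℕ (suc q)

    -- Where an entry of the core now sits: the diverted ones are in column `i`, all others in their
    -- shifted column.
    source : Fin (suc q) → Fin (suc q) → Fin (suc (suc q))
    source r c = if does (c ≟ fromℕ q) ∧ does (toℕ r ℕ.<? toℕ i) then i else punchIn i c

    block-entry : Fin (suc q) → Fin (suc q) → ℕ
    block-entry r c = entry B (punchIn i r) (source r c)

    -- Only the border of this matrix is used; its zeros are those required by `Reduced`.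
    outer-entry : Fin (suc (suc q)) → Fin (suc (suc q)) → ℕ
    outer-entry r c = if does (c ≟ last) ∧ does (r ≤? i) then entry B r c else 0

  -- Gluing with `replaceLeading` makes its lemmas on core and border apply.
  unmove : Matrix (suc (suc q))
  unmove = replaceLeading (build block-entry) (build outer-entry)

  private
    unmove-block : ∀ r c → entry unmove (inject₁ r) (inject₁ c) ≡ block-entry r c
    unmove-block r c = trans (replaceLeading-core (build block-entry) (build outer-entry) r c)
                             (entry-build block-entry r c)

    unmove-last : ∀ r → entry unmove r last ≡ outer-entry r last
    unmove-last r = trans (replaceLeading-last-column (build block-entry) (build outer-entry) r)
                          (entry-build outer-entry r last)

  unmove-reduced : Reduced unmove i
  unmove-reduced = record
    { last-row = λ c → trans
        (replaceLeading-last-row (build block-entry) (build outer-entry) (inject₁ c))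
        (trans (entry-build outer-entry last (inject₁ c))
               (if-∧-false (inject₁ c ≟ last) (last ≤? i) (inject₁≢fromℕ c ∘ proj₁)))
    ; below    = λ r i<r → trans (unmove-last r)
        (if-∧-false (last ≟ last) (r ≤? i) λ (_ , r≤i) → ℕ.<⇒≱ i<r r≤i)
    }

  unmove-moves : UpperTriangular B → IsPivot B i → i ≢ last → Moves unmove i B
  unmove-moves upper piv i≢last = record
    { pivot-row    = IsPivot.zero-row piv
    ; last-column  = λ r r≤i → sym (trans (unmove-last r) (if-∧-true (last ≟ last) (r ≤? i) refl r≤i))
    ; block        = λ r c h → sym (trans (unmove-block r c) (cong (entry B (punchIn i r))
        (if-∧-false (c ≟ fromℕ q) (toℕ r ℕ.<? toℕ i) λ (c≡ , r<i) → ℕ.<⇒≱ r<i (h c≡))))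
    ; column-above = λ r r<i → sym (trans (unmove-block r (fromℕ q)) (cong (entry B (punchIn i r))
        (if-∧-true (fromℕ q ≟ fromℕ q) (toℕ r ℕ.<? toℕ i) refl r<i)))
    ; column-below = λ r i≤r → upper (punchIn i r) i (pivot<punchIn i r i≤r)
    }

-- The map α

α-fixed : {A : Matrix (suc p)} → IsLowest A (fromℕ p) (fromℕ p) → α A ≡ A
α-fixed {p} {A} low rewrite isLowest⇒rmax A low | dec-true (fromℕ p ≟ fromℕ p) refl = refl

α-moved : {A : Matrix (suc p)} {i : Fin (suc p)} → IsLowest A (fromℕ p) i → i ≢ fromℕ p →
          α A ≡ Move.moved A i
α-moved {p} {A} {i} low i≢last rewrite isLowest⇒rmax A low | dec-false (i ≟ fromℕ p) i≢last = refl

α-moves : {A : Matrix (suc (suc q))} {i : Fin (suc (suc q))} →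
          IsLowest A (fromℕ (suc q)) i → i ≢ fromℕ (suc q) → Moves A i (α A)
α-moves {A = A} {i} low i≢last = subst (Moves A i) (sym (α-moved low i≢last)) (moved-moves A i i≢last)

lowest-exists : (A : Matrix m) {c : Fin m} → NonZeroColumn A c → ∃ (IsLowest A c)
lowest-exists A nz with i , eq ← rmax-exists A nz = i , rmax⇒isLowest A eq

suc-toℕ≡⇒≡fromℕ : (j : Fin (suc q)) → suc (toℕ j) ≡ suc q → j ≡ fromℕ q
suc-toℕ≡⇒≡fromℕ {q} j eq = Fin.toℕ-injective (trans (ℕ.suc-injective eq) (sym (Fin.toℕ-fromℕ q)))

-- A genuine move requires dimension at least two. The case `higher` therefore also yields the shape
-- `suc q` on which `Moves` is stated.
data LowestPosition (p : ℕ) (i : Fin (suc p)) : Set where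
  bottom : i ≡ fromℕ p → LowestPosition p i
  higher : ∀ q → p ≡ suc q → i ≢ fromℕ p → LowestPosition p i

lowestPosition : (i : Fin (suc p)) → LowestPosition p i
lowestPosition {zero}  zero = bottom refl
lowestPosition {suc q} i with i ≟ fromℕ (suc q)
... | yes i≡last = bottom i≡last
... | no  i≢last = higher q refl i≢last

before-core⁺ : {A : Matrix (suc p)} → UpperTriangular A → ∀ {j x} →
               PositiveBefore A (inject₁ j) x → PositiveBefore (core A) j x
before-core⁺ {p} {A} upper {j} {x} (r , r<x , pos) with view r
... | ‵fromℕ     = contradiction (upper (fromℕ p) (inject₁ j) (inject₁<fromℕ j)) (ℕ.>⇒≢ pos)
... | ‵inject₁ r′ = r′ , subst (ℕ._< x) (Fin.toℕ-inject₁ r′) r<x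
                      , subst (0 ℕ.<_) (sym (entry-core A r′ j)) pos

before-core⁻ : {A : Matrix (suc p)} → ∀ {j x} →
               PositiveBefore (core A) j x → PositiveBefore A (inject₁ j) x
before-core⁻ {A = A} {j} {x} (r , r<x , pos) =
  inject₁ r , subst (ℕ._< x) (sym (Fin.toℕ-inject₁ r)) r<x , subst (0 ℕ.<_) (entry-core A r j) pos

column-core⁺ : {A : Matrix (suc p)} → UpperTriangular A → ∀ {j} →
               NonZeroColumn A (inject₁ j) → NonZeroColumn (core A) j
column-core⁺ {p} {A} upper {j} (r , pos) with view r
... | ‵fromℕ     = contradiction (upper (fromℕ p) (inject₁ j) (inject₁<fromℕ j)) (ℕ.>⇒≢ pos)
... | ‵inject₁ r′ = r′ , subst (0 ℕ.<_) (sym (entry-core A r′ j)) pos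

upper-core : {A : Matrix (suc p)} → UpperTriangular A → UpperTriangular (core A)
upper-core {A = A} upper r c c<r =
  trans (entry-core A r c) (upper (inject₁ r) (inject₁ c) (inject₁-mono-< c<r))

border⇒upper : {A : Matrix (suc p)} → UpperTriangular (core A) →
              (∀ c → entry A (fromℕ p) (inject₁ c) ≡ 0) → UpperTriangular A
border⇒upper {A = A} upper zeros r c c<r with ≢fromℕ⇒inject₁ c (<⇒≢fromℕ c<r) | view r
... | c′ , refl | ‵fromℕ      = zeros c′
... | c′ , refl | ‵inject₁ r′ =
  trans (sym (entry-core A r′ c′)) (upper r′ c′ (inject₁-cancel-< c<r))

-- before⁺ and before⁻ say that the last columns have the same rmin.
record Transforms (A B : Matrix m) : Set where
  field
    admissible : Admissible B
    weight≡    : weight B ≡ weight A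
    before⁺    : ∀ c → suc (toℕ c) ≡ m → ∀ x → PositiveBefore A c x → PositiveBefore B c x
    before⁻    : ∀ c → suc (toℕ c) ≡ m → ∀ x → PositiveBefore B c x → PositiveBefore A c x

lowest-last : {A : Matrix (suc p)} → UpperTriangular A → 0 ℕ.< entry A (fromℕ p) (fromℕ p) →
              IsLowest A (fromℕ p) (fromℕ p)
lowest-last upper pos = record
  { positive = pos ; below = λ r last<r → contradiction (Fin.≤fromℕ r) (ℕ.<⇒≱ last<r) }

prepared⇒admissible : {A : Matrix (suc p)} → Prepared A →
                      0 ℕ.< entry A (fromℕ p) (fromℕ p) → Admissible A
prepared⇒admissible {p} {A} prep pos = record { upper = upper ; rows = rows ; columns = columns }
  where
  open Prepared prep
  rows : ∀ r → NonZeroRow A r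
  rows r with view r
  ... | ‵fromℕ      = fromℕ p , pos
  ... | ‵inject₁ r′ with c , pos ← Admissible.rows core-adm r′ =
    inject₁ c , subst (0 ℕ.<_) (entry-core A r′ c) pos
  columns : ∀ c → NonZeroColumn A c
  columns c with view c
  ... | ‵fromℕ      = fromℕ p , pos
  ... | ‵inject₁ c′ with r , pos ← Admissible.columns core-adm c′ =
    inject₁ r , subst (0 ℕ.<_) (entry-core A r c′) pos

α-isPivot : {A : Matrix (suc p)} {i : Fin (suc p)} →
            Prepared A → IsLowest A (fromℕ p) i → IsPivot (α A) i
α-isPivot {p} {A} {i} prep low with lowestPosition i
... | higher q refl i≢last =
  Forward.moves-isPivot i≢last (Prepared.upper prep) low (α-moves low i≢last) (Prepared.core-adm prep)
... | bottom refl rewrite α-fixed low = record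
  { zero-row = λ c c≢ → Prepared.upper prep (fromℕ p) c (Fin.≤∧≢⇒< (Fin.≤fromℕ c) c≢)
  ; above    = above
  }
  where
  above : ∀ r → r < fromℕ p → ∃ λ c → c ≢ fromℕ p × 0 ℕ.< entry A r c
  above r r<last with r′ , refl ← ≢fromℕ⇒inject₁ r (<⇒≢fromℕ r<last)
    with c , pos ← Admissible.rows (Prepared.core-adm prep) r′ =
    inject₁ c , inject₁≢fromℕ c , subst (0 ℕ.<_) (entry-core A r′ c) pos

α-transforms : {A : Matrix (suc p)} → Prepared A → Transforms A (α A)
α-transforms {p} {A} prep with i , low ← lowest-exists A (Prepared.last-column prep) with lowestPosition i
... | bottom refl rewrite α-fixed low = record
  { admissible = prepared⇒admissible prep (IsLowest.positive low)
  ; weight≡    = refl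
  ; before⁺    = λ _ _ _ b → b
  ; before⁻    = λ _ _ _ b → b
  }
... | higher q refl i≢last = record
  { admissible = moves-admissible (Prepared.core-adm prep)
                   (Prepared.linked prep (fromℕ q) (cong suc (Fin.toℕ-fromℕ q)))
  ; weight≡    = moves-weight
  ; before⁺    = λ c eq → subst (λ c → ∀ x → PositiveBefore A c x → PositiveBefore (α A) c x)
                            (sym (suc-toℕ≡⇒≡fromℕ c eq)) moves-before⁺
  ; before⁻    = λ c eq → subst (λ c → ∀ x → PositiveBefore (α A) c x → PositiveBefore A c x)
                            (sym (suc-toℕ≡⇒≡fromℕ c eq)) moves-before⁻
  }
  where open Forward i≢last (Prepared.upper prep) low (α-moves low i≢last)

-- The common image has a single pivot, so both preimages were moved with the same `i`, or both were
-- fixed.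
α-injective : {A A′ : Matrix (suc p)} → Prepared A → Prepared A′ → α A ≡ α A′ → A ≡ A′
α-injective {p} {A} {A′} prep prep′ eq
  with i  , low  ← lowest-exists A (Prepared.last-column prep)
     | i′ , low′ ← lowest-exists A′ (Prepared.last-column prep′)
  with refl ← isPivot-unique (α-isPivot prep low) (subst (λ B → IsPivot B i′) (sym eq) (α-isPivot prep′ low′))
  with lowestPosition i
... | bottom refl = trans (sym (α-fixed low)) (trans eq (α-fixed low′))
... | higher q refl i≢last = moves-injective
  (reduced (Prepared.upper prep) low) (reduced (Prepared.upper prep′) low′)
  (α-moves low i≢last) (subst (Moves A′ i) (sym eq) (α-moves low′ i≢last))

last-positive : {B : Matrix (suc p)} → Admissible B → 0 ℕ.< entry B (fromℕ p) (fromℕ p)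
last-positive {p} adm with c , pos ← Admissible.rows adm (fromℕ p) with c ≟ fromℕ p
... | yes refl = pos
... | no  c≢   = contradiction (Admissible.upper adm (fromℕ p) c
                                 (Fin.≤∧≢⇒< (Fin.≤fromℕ c) c≢)) (ℕ.>⇒≢ pos)

pivot-last⇒prepared : {B : Matrix (suc p)} → Admissible B → IsPivot B (fromℕ p) → Prepared B
pivot-last⇒prepared {p} {B} adm piv = record
  { upper       = upper
  ; core-adm    = record
      { upper   = upper-core upper
      ; rows    = core-rows
      ; columns = λ c → column-core⁺ upper (columns (inject₁ c))
      }
  ; last-column = columns (fromℕ p)
  -- The positive corner serves as the upper end of the link; by triangularity every positive entry
  -- of the preceding column lies above the last row.
  ; linked      = λ j _ → let r , pos = columns (inject₁ j) in
      fromℕ p , (r , ℕ.≤-<-trans (ℕ.≮⇒≥ λ j<r → ℕ.>⇒≢ pos (upper r (inject₁ j) j<r))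
                                 (inject₁<fromℕ j) , pos)
              , last-positive adm
  }
  where
  open Admissible adm
  core-rows : ∀ r → NonZeroRow (core B) r
  core-rows r with c , c≢ , pos ← IsPivot.above piv (inject₁ r) (inject₁<fromℕ r)
    with c′ , refl ← ≢fromℕ⇒inject₁ c c≢ = c′ , subst (0 ℕ.<_) (sym (entry-core B r c′)) pos

α-surjective : {B : Matrix (suc p)} → Admissible B → ∃ λ A → Prepared A × α A ≡ B
α-surjective {p} {B} adm with i , piv ← isPivot-exists B (Admissible.upper adm) with lowestPosition i
... | bottom refl = B ,
      pivot-last⇒prepared adm piv ,
      α-fixed (lowest-last (Admissible.upper adm) (last-positive adm))
... | higher q refl i≢last = unmove B i , prepared ,
      moves-functional i≢last (α-moves isLowest i≢last) moves
  where
  moves = unmove-moves B i (Admissible.upper adm) piv i≢last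
  open Backward i≢last adm piv (unmove-reduced B i) moves

-- The map θ

replaceLeading-full : (B A : Matrix m) → replaceLeading B A ≡ B
replaceLeading-full B A = matrix-ext λ r c →
  trans (replaceLeading-inside B A r c (Fin.toℕ<n r) (Fin.toℕ<n c))
        (cong₂ (entry B) (Fin.fromℕ<-toℕ r (Fin.toℕ<n r)) (Fin.fromℕ<-toℕ c (Fin.toℕ<n c)))

leading-full : (m≤m : m ℕ.≤ m) (A : Matrix m) → leading m≤m A ≡ A
leading-full m≤m A = matrix-ext λ r c →
  trans (entry-leading m≤m A r c) (cong₂ (entry A) (Fin.inject≤-refl r m≤m) (Fin.inject≤-refl c m≤m))

leading-core : (k≤p : k ℕ.≤ p) (k≤1+p : k ℕ.≤ suc p) (A : Matrix (suc p)) →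
               leading k≤p (core A) ≡ leading k≤1+p A
leading-core {k} {p} k≤p k≤1+p A = matrix-ext λ r c → begin
  entry (leading k≤p (core A)) r c               ≡⟨ entry-leading k≤p (core A) r c ⟩
  entry (core A) (inject≤ r k≤p) (inject≤ c k≤p)
    ≡⟨ entry-leading (ℕ.n≤1+n p) A (inject≤ r k≤p) (inject≤ c k≤p) ⟩
  entry A (inject≤ (inject≤ r k≤p) (ℕ.n≤1+n p)) (inject≤ (inject≤ c k≤p) (ℕ.n≤1+n p))
    ≡⟨ cong₂ (entry A) (Fin.inject≤-idempotent r k≤p (ℕ.n≤1+n p) k≤1+p)
                       (Fin.inject≤-idempotent c k≤p (ℕ.n≤1+n p) k≤1+p) ⟩
  entry A (inject≤ r k≤1+p) (inject≤ c k≤1+p)    ≡⟨ entry-leading k≤1+p A r c ⟨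
  entry (leading k≤1+p A) r c                    ∎
  where open ≡-Reasoning

core-replaceLeading-commute : (C : Matrix k) (A : Matrix (suc p)) →
                              core (replaceLeading C A) ≡ replaceLeading C (core A)
core-replaceLeading-commute {k} C A = matrix-ext λ r c → trans (entry-core (replaceLeading C A) r c) (go r c)
  where
  go : ∀ r c → entry (replaceLeading C A) (inject₁ r) (inject₁ c) ≡ entry (replaceLeading C (core A)) r c
  go r c with (toℕ r ℕ.<? k) ×-dec (toℕ c ℕ.<? k)
  ... | yes (r<k , c<k) = trans
          (replaceLeading-inside C A (inject₁ r) (inject₁ c) r<k′ c<k′)
          (trans (cong₂ (entry C) (Fin.fromℕ<-cong _ _ (Fin.toℕ-inject₁ r) r<k′ r<k)
                                  (Fin.fromℕ<-cong _ _ (Fin.toℕ-inject₁ c) c<k′ c<k))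
                 (sym (replaceLeading-inside C (core A) r c r<k c<k)))
    where
    r<k′ = subst (ℕ._< k) (sym (Fin.toℕ-inject₁ r)) r<k
    c<k′ = subst (ℕ._< k) (sym (Fin.toℕ-inject₁ c)) c<k
  ... | no ¬p = trans
          (replaceLeading-outside C A (inject₁ r) (inject₁ c) λ (r<k , c<k) →
            ¬p (subst (ℕ._< k) (Fin.toℕ-inject₁ r) r<k , subst (ℕ._< k) (Fin.toℕ-inject₁ c) c<k))
          (trans (sym (entry-core A r c)) (sym (replaceLeading-outside C (core A) r c ¬p)))

-- The first `k ≤ p` steps read and write only leading blocks of size at most `p`, so they commute
-- with dropping the border.
steps-core : ∀ k (k≤p : k ℕ.≤ p) (k≤1+p : k ℕ.≤ suc p) (A : Matrix (suc p)) →
             core (steps k k≤1+p A) ≡ steps k k≤p (core A)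
steps-core zero    _   _     A = refl
steps-core (suc k) k<p k<1+p A = begin
  core (αₖ k<1+p X)
    ≡⟨ core-replaceLeading-commute (α (leading k<1+p X)) X ⟩
  replaceLeading (α (leading k<1+p X)) (core X)
    ≡⟨ cong (λ L → replaceLeading (α L) (core X)) (leading-core k<p k<1+p X) ⟨
  αₖ k<p (core X)
    ≡⟨ cong (αₖ k<p) (steps-core k (ℕ.<⇒≤ k<p) (ℕ.<⇒≤ k<1+p) A) ⟩
  αₖ k<p (steps k (ℕ.<⇒≤ k<p) (core A)) ∎
  where
  open ≡-Reasoning
  X = steps k (ℕ.<⇒≤ k<1+p) A

steps-outside : ∀ k (k≤m : k ℕ.≤ m) (A : Matrix m) (r c : Fin m) →
                ¬ (toℕ r ℕ.< k × toℕ c ℕ.< k) → entry (steps k k≤m A) r c ≡ entry A r c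
steps-outside zero    _   A r c _  = refl
steps-outside (suc k) k<m A r c ¬p = trans
  (replaceLeading-outside (α (leading k<m (steps k (ℕ.<⇒≤ k<m) A))) (steps k (ℕ.<⇒≤ k<m) A) r c ¬p)
  (steps-outside k (ℕ.<⇒≤ k<m) A r c λ (r<k , c<k) → ¬p (ℕ.m<n⇒m<1+n r<k , ℕ.m<n⇒m<1+n c<k))

-- Recursion of θ on the dimension

Θ : Matrix m → Matrix m
Θ {m} = steps m ℕ.≤-refl

-- All steps but the last: the core is already transformed, the border still original.
Θ⁻ : Matrix (suc p) → Matrix (suc p)
Θ⁻ {p} = steps p (ℕ.n≤1+n p)

Θ-suc : (A : Matrix (suc p)) → Θ A ≡ α (Θ⁻ A)
Θ-suc {p} A = begin
  replaceLeading (α (leading ℕ.≤-refl X)) X ≡⟨ replaceLeading-full (α (leading ℕ.≤-refl X)) X ⟩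
  α (leading ℕ.≤-refl X)                    ≡⟨ cong α (leading-full ℕ.≤-refl X) ⟩
  -- The two sides differ only in the proof of `p ≤ suc p` carried by `steps`.
  α X                                       ≡⟨ cong (λ le → α (steps p le A)) (ℕ.≤-irrelevant _ _) ⟩
  α (Θ⁻ A)                                  ∎
  where
  open ≡-Reasoning
  X = steps p (ℕ.<⇒≤ (ℕ.≤-refl {suc p})) A

record SameBorder (A B : Matrix (suc p)) : Set where
  field
    last-column : ∀ r → entry A r (fromℕ p) ≡ entry B r (fromℕ p)
    last-row    : ∀ c → entry A (fromℕ p) c ≡ entry B (fromℕ p) c

core-border-ext : {A B : Matrix (suc p)} → core A ≡ core B → SameBorder A B → A ≡ B
core-border-ext {A = A} {B} core≡ border = matrix-ext go
  where
  open SameBorder border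
  go : ∀ r c → entry A r c ≡ entry B r c
  go r c with view r | view c
  ... | ‵fromℕ      | _           = last-row c
  ... | ‵inject₁ _  | ‵fromℕ      = last-column r
  ... | ‵inject₁ r′ | ‵inject₁ c′ =
    trans (sym (entry-core A r′ c′)) (trans (cong (λ C → entry C r′ c′) core≡) (entry-core B r′ c′))

Θ⁻-border : (A : Matrix (suc p)) → SameBorder (Θ⁻ A) A
Θ⁻-border {p} A = record
  { last-column = λ r → steps-outside p (ℕ.n≤1+n p) A r (fromℕ p) λ (_ , lt) →
      ℕ.<-irrefl (Fin.toℕ-fromℕ p) lt
  ; last-row    = λ c → steps-outside p (ℕ.n≤1+n p) A (fromℕ p) c λ (lt , _) →
      ℕ.<-irrefl (Fin.toℕ-fromℕ p) lt
  }

Θ⁻-core : (A : Matrix (suc p)) → core (Θ⁻ A) ≡ Θ (core A)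
Θ⁻-core {p} A = steps-core p ℕ.≤-refl (ℕ.n≤1+n p) A

-- The conditions of `IsFishburn′` without the weight, with `Linked` in place of the extremal
-- indices.
record Admissible′ (A : Matrix m) : Set where
  field
    upper   : UpperTriangular A
    columns : ∀ j → NonZeroColumn A j
    linked  : ∀ j j⁺ → toℕ j⁺ ≡ suc (toℕ j) → Linked A j j⁺

core-admissible′ : {A : Matrix (suc p)} → Admissible′ A → Admissible′ (core A)
core-admissible′ {p} {A} adm = record
  { upper   = upper-core upper
  ; columns = λ c → column-core⁺ upper (columns (inject₁ c))
  ; linked  = λ j j⁺ eq → go (linked (inject₁ j) (inject₁ j⁺)
      (trans (Fin.toℕ-inject₁ j⁺) (trans eq (cong suc (sym (Fin.toℕ-inject₁ j))))))
  }
  where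
  open Admissible′ adm
  go : ∀ {j j⁺} → Linked A (inject₁ j) (inject₁ j⁺) → Linked (core A) j j⁺
  go {j} {j⁺} (s , before , pos) with view s
  ... | ‵fromℕ      = contradiction (upper (fromℕ p) (inject₁ j⁺) (inject₁<fromℕ j⁺)) (ℕ.>⇒≢ pos)
  ... | ‵inject₁ s′ = s′ , subst (PositiveBefore (core A) j) (Fin.toℕ-inject₁ s′) (before-core⁺ upper before)
                         , subst (0 ℕ.<_) (sym (entry-core A s′ j⁺)) pos

module _ {A X : Matrix (suc p)} (trf : Transforms (core A) (core X)) (border : SameBorder X A) where
  open Transforms trf
  open SameBorder border

  border-weight : UpperTriangular A → UpperTriangular X → weight X ≡ weight A
  border-weight upperA upperX = trans (weight-core X upperX)
    (trans (cong₂ _+_ weight≡ (sum-cong-≗ last-column)) (sym (weight-core A upperA)))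

  -- The last column of `X` is that of `A`, and `before⁺` carries rmin of the preceding column from
  -- the core of `A` to that of `X`; so the last link survives.
  prepared : Admissible′ A → Prepared X
  prepared adm = record
    { upper       = border⇒upper (Admissible.upper admissible) λ c →
        trans (last-row (inject₁ c)) (upper (fromℕ p) (inject₁ c) (inject₁<fromℕ c))
    ; core-adm    = admissible
    ; last-column = let r , pos = columns (fromℕ p) in r , subst (0 ℕ.<_) (sym (last-column r)) pos
    ; linked      = λ j 1+j≡p →
        let s , before , pos = linked (inject₁ j) (fromℕ p)
              (trans (Fin.toℕ-fromℕ p) (trans (sym 1+j≡p) (cong suc (sym (Fin.toℕ-inject₁ j)))))
        in s , before-core⁻ {A = X} (before⁺ j 1+j≡p (toℕ s) (before-core⁺ upper before))
             , subst (0 ℕ.<_) (sym (last-column s)) pos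
    }
    where open Admissible′ adm

  -- The converse, needed to show that a constructed preimage lies in the domain. Links inside the
  -- core are assumed, and the one to the last column returns through `before⁻`.
  prepared⇒admissible′ : Admissible′ (core A) → Prepared X → Admissible′ A
  prepared⇒admissible′ adm prep = record { upper = upperA ; columns = columnsA ; linked = linkedA }
    where
    upperX = Prepared.upper prep

    upperA : UpperTriangular A
    upperA = border⇒upper (Admissible′.upper adm) λ c →
      trans (sym (last-row (inject₁ c))) (upperX (fromℕ p) (inject₁ c) (inject₁<fromℕ c))

    columnsA : ∀ c → NonZeroColumn A c
    columnsA c with view c
    ... | ‵fromℕ with r , pos ← Prepared.last-column prep = r , subst (0 ℕ.<_) (last-column r) pos
    ... | ‵inject₁ c′ with r , pos ← Admissible′.columns adm c′ =
      inject₁ r , subst (0 ℕ.<_) (entry-core A r c′) pos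

    linkedA : ∀ j j⁺ → toℕ j⁺ ≡ suc (toℕ j) → Linked A j j⁺
    linkedA j j⁺ eq with ≢fromℕ⇒inject₁ j (<⇒≢fromℕ {j = j⁺} (ℕ.≤-reflexive (sym eq))) | view j⁺
    ... | j′ , refl | ‵inject₁ j⁺′
      with s , before , pos ← Admissible′.linked adm j′ j⁺′
             (trans (sym (Fin.toℕ-inject₁ j⁺′)) (trans eq (cong suc (Fin.toℕ-inject₁ j′)))) =
      inject₁ s , subst (PositiveBefore A (inject₁ j′)) (sym (Fin.toℕ-inject₁ s)) (before-core⁻ {A = A} before)
                , subst (0 ℕ.<_) (entry-core A s j⁺′) pos
    ... | j′ , refl | ‵fromℕ
      with 1+j≡p ← trans (cong suc (sym (Fin.toℕ-inject₁ j′))) (trans (sym eq) (Fin.toℕ-fromℕ p))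
      with s , before , pos ← Prepared.linked prep j′ 1+j≡p =
      s , before-core⁻ {A = A} (before⁻ j′ 1+j≡p (toℕ s) (before-core⁺ upperX before))
        , subst (0 ℕ.<_) (last-column s) pos

  transforms-border : {B : Matrix (suc p)} → Admissible′ A → Transforms X B → Transforms A B
  transforms-border adm trf′ = record
    { admissible = T.admissible
    ; weight≡    = trans T.weight≡ (border-weight (Admissible′.upper adm) (Prepared.upper (prepared adm)))
    ; before⁺    = λ c eq x (r , r<x , pos) → T.before⁺ c eq x
        (r , r<x , subst (0 ℕ.<_) (sym (same c eq r)) pos)
    ; before⁻    = λ c eq x before → let r , r<x , pos = T.before⁻ c eq x before in
        r , r<x , subst (0 ℕ.<_) (same c eq r) pos
    }
    where
    module T = Transforms trf′
    same : ∀ c → suc (toℕ c) ≡ suc p → ∀ r → entry X r c ≡ entry A r c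
    same c eq r = subst (λ c → entry X r c ≡ entry A r c) (sym (suc-toℕ≡⇒≡fromℕ c eq)) (last-column r)

-- Admissibility of the image alone would not carry the induction: the next larger block needs rmin
-- of this last column to verify its own link.
Θ-transforms : (A : Matrix m) → Admissible′ A → Transforms A (Θ A)
Θ⁻-transforms : (A : Matrix (suc p)) → Admissible′ A → Transforms (core A) (core (Θ⁻ A))

Θ-transforms {zero} [] adm = record
  { admissible = record { upper = λ () ; rows = λ () ; columns = λ () }
  ; weight≡    = refl
  ; before⁺    = λ ()
  ; before⁻    = λ ()
  }
Θ-transforms {suc p} A adm = subst (Transforms A) (sym (Θ-suc A))
  (transforms-border (Θ⁻-transforms A adm) (Θ⁻-border A) adm
    (α-transforms (prepared (Θ⁻-transforms A adm) (Θ⁻-border A) adm)))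

Θ⁻-transforms A adm =
  subst (Transforms (core A)) (sym (Θ⁻-core A)) (Θ-transforms (core A) (core-admissible′ adm))

Θ⁻-prepared : (A : Matrix (suc p)) → Admissible′ A → Prepared (Θ⁻ A)
Θ⁻-prepared A adm = prepared (Θ⁻-transforms A adm) (Θ⁻-border A) adm

Θ-injective : {A A′ : Matrix m} → Admissible′ A → Admissible′ A′ → Θ A ≡ Θ A′ → A ≡ A′
Θ-injective {zero}  {[]} {[]} _ _ _ = refl
Θ-injective {suc p} {A} {A′} adm adm′ eq = core-border-ext
  (Θ-injective (core-admissible′ adm) (core-admissible′ adm′)
    (trans (sym (Θ⁻-core A)) (trans (cong core Θ⁻≡) (Θ⁻-core A′))))
  (record
    { last-column = λ r → trans (sym (B.last-column r))
        (trans (cong (λ X → entry X r (fromℕ p)) Θ⁻≡) (B′.last-column r))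
    ; last-row    = λ c → trans (sym (B.last-row c))
        (trans (cong (λ X → entry X (fromℕ p) c) Θ⁻≡) (B′.last-row c))
    })
  where
  module B  = SameBorder (Θ⁻-border A)
  module B′ = SameBorder (Θ⁻-border A′)
  Θ⁻≡ : Θ⁻ A ≡ Θ⁻ A′
  Θ⁻≡ = α-injective (Θ⁻-prepared A adm) (Θ⁻-prepared A′ adm′)
          (trans (sym (Θ-suc A)) (trans eq (Θ-suc A′)))

Θ-surjective : {B : Matrix m} → Admissible B → ∃ λ A → Admissible′ A × Θ A ≡ B
Θ-surjective {zero}  {[]} _ = [] , record { upper = λ () ; columns = λ () ; linked = λ () } , refl
Θ-surjective {suc p} {B} adm
  with X , prep , refl ← α-surjective adm
  with C , admC , ΘC≡ ← Θ-surjective (Prepared.core-adm prep) =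
  A , admA , trans (Θ-suc A) (cong α Θ⁻A≡X)
  where
  -- Undoing `α` gives `X`; undoing θ on its core gives `C`; the border of `X` is kept, since the
  -- steps before the last never touch it.
  A = replaceLeading C X
  core≡ : core A ≡ C
  core≡ = core-replaceLeading C X
  border : SameBorder X A
  border = record
    { last-column = λ r → sym (replaceLeading-last-column C X r)
    ; last-row    = λ c → sym (replaceLeading-last-row C X c)
    }
  admA : Admissible′ A
  admA = prepared⇒admissible′ (subst₂ Transforms (sym core≡) ΘC≡ (Θ-transforms C admC)) border
           (subst Admissible′ (sym core≡) admC) prep
  Θ⁻A≡X : Θ⁻ A ≡ X
  Θ⁻A≡X = core-border-ext (trans (Θ⁻-core A) (trans (cong Θ core≡) ΘC≡)) (record
    { last-column = λ r → trans (SameBorder.last-column (Θ⁻-border A) r) (replaceLeading-last-column C X r)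
    ; last-row    = λ c → trans (SameBorder.last-row (Θ⁻-border A) c) (replaceLeading-last-row C X c)
    })

-- Restoring the weight and passing to pairs of a dimension and a matrix

isFishburn : {A : Matrix m} → weight A ≡ n → Admissible A → IsFishburn n A
isFishburn w adm = record
  { weight≡n = w ; upperTriangular = upper ; nonZeroRows = rows ; nonZeroColumns = columns }
  where open Admissible adm

isFishburn⇒admissible : {A : Matrix m} → IsFishburn n A → Admissible A
isFishburn⇒admissible fish = record
  { upper = upperTriangular ; rows = nonZeroRows ; columns = nonZeroColumns }
  where open IsFishburn fish

isFishburn′ : {A : Matrix m} → weight A ≡ n → Admissible′ A → IsFishburn′ n A
isFishburn′ {A = A} w adm = record
  { weight≡n        = w
  ; upperTriangular = upper
  ; nonZeroColumns  = columns
  ; rmin<rmax       = λ j j⁺ eq → linked⇒rmin<rmax A (linked j j⁺ eq)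
  }
  where open Admissible′ adm

isFishburn′⇒admissible′ : {A : Matrix m} → IsFishburn′ n A → Admissible′ A
isFishburn′⇒admissible′ {A = A} fish = record
  { upper   = upperTriangular
  ; columns = nonZeroColumns
  ; linked  = λ j j⁺ eq → rmin<rmax⇒linked A (rmin<rmax j j⁺ eq)
  }
  where open IsFishburn′ fish

-- Stated for arbitrary `A` and `B` so that `refl` can be matched; for two values of `θ` the second
-- components are not variables and unification would be stuck.
Σ-≡⁻ : {A : Matrix m} {B : Matrix n} → _≡_ {A = SquareMatrix} (m , A) (n , B) →
       ∃ λ (eq : m ≡ n) → subst Matrix eq A ≡ B
Σ-≡⁻ refl = refl , refl

theorem4p8 : ∀ (n : ℕ) → n ≥ 1 →
    Σ[ θ-maps ∈ (∀ {A} → A ∈ 𝓜′ n → θ A ∈ 𝓜 n) ]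
    Bijective {A = ∃ (𝓜′ n)} {B = ∃ (𝓜 n)}
    (_≡_ on proj₁) (_≡_ on proj₁) (map θ θ-maps)
theorem4p8 n _ = θ-maps , (λ {x} {y} → injective {x} {y}) , surjective
  where
  θ-maps : ∀ {A} → A ∈ 𝓜′ n → θ A ∈ 𝓜 n
  θ-maps {_ , A} fish = isFishburn (trans weight≡ (IsFishburn′.weight≡n fish)) admissible
    where open Transforms (Θ-transforms A (isFishburn′⇒admissible′ fish))

  injective : ∀ {x y : ∃ (𝓜′ n)} → θ (proj₁ x) ≡ θ (proj₁ y) → proj₁ x ≡ proj₁ y
  injective {(m , A) , fish} {(m′ , A′) , fish′} eq with refl , ΘA≡ΘA′ ← Σ-≡⁻ eq =
    cong (m ,_) (Θ-injective (isFishburn′⇒admissible′ fish) (isFishburn′⇒admissible′ fish′) ΘA≡ΘA′)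

  surjective : ∀ (y : ∃ (𝓜 n)) → ∃ λ (x : ∃ (𝓜′ n)) → ∀ {z : ∃ (𝓜′ n)} →
               proj₁ z ≡ proj₁ x → θ (proj₁ z) ≡ proj₁ y
  surjective ((m , B) , fish) with A , adm , refl ← Θ-surjective (isFishburn⇒admissible fish) =
    ((m , A) , isFishburn′ (trans (sym (Transforms.weight≡ (Θ-transforms A adm)))
                                  (IsFishburn.weight≡n fish)) adm)
    , λ { {_ , _} refl → refl }
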